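{- Let $P$ be an LTS with signature $\{A^r,A^l,A^{bi}\}$ and let $\varphi$ be a formula of covariant-contravariant modal logic over this signature. Then for each $p\in P$: $(P,p)\models\varphi$ (in covariant-contravariant modal logic) if and only if $(\mathcal{M}(P),p)\models\mathcal{M}(\varphi)$ (in Boudol-Larsen modal logic), where $\mathcal{M}(\varphi)=\varphi$ regarded as a Boudol-Larsen formula over $A=A^r\cup A^l\cup A^{bi}$.
   Context: A modal transition system (MTS) over a set of actions $A$ is a triple $(P,\to_\Diamond,\to_\Box)$ with $P$ a set of states and $\to_\Box\subseteq\to_\Diamond\subseteq P\times A\times P$ (must transitions $\to_\Box$, may transitions $\to_\Diamond$). A labelled transition system (LTS) over $A$ is a set of states $P$ with a transition relation $\to\subseteq P\times A\times P$; a signature is a partition $\{A^r,A^l,A^{bi}\}$ of $A$ into pairwise disjoint, possibly empty sets. Boudol-Larsen formulae over $A$: $\varphi::=\bot\mid\top\mid\varphi\wedge\varphi\mid\varphi\vee\varphi\mid[a]\varphi\mid\langle a\rangle\varphi$ ($a\in A$), interpreted at a state $p$ of an MTS $P$: $\top$ always holds, $\bot$ never, $\wedge,\vee$ as usual; $(P,p)\models[a]\varphi$ iff $(P,p')\models\varphi$ for all $p\xrightarrow{a}_\Diamond p'$; $(P,p)\models\langle a\rangle\varphi$ iff $(P,p')\models\varphi$ for some $p\xrightarrow{a}_\Box p'$. Covariant-contravariant formulae over $\{A^r,A^l,A^{bi}\}$: $\varphi::=\bot\mid\top\mid\varphi\wedge\varphi\mid\varphi\vee\varphi\mid[b]\varphi\mid\langle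 a\rangle\varphi$ ($a\in A^r\cup A^{bi}$, $b\in A^l\cup A^{bi}$), interpreted at a state $p$ of an LTS $P$: Boolean cases as usual; $(P,p)\models[b]\varphi$ iff $(P,p')\models\varphi$ for all $p\xrightarrow{b}p'$; $(P,p)\models\langle a\rangle\varphi$ iff $(P,p')\models\varphi$ for some $p\xrightarrow{a}p'$. For an LTS $P$ with signature $\{A^r,A^l,A^{bi}\}$, the MTS $\mathcal{M}(P)$ over $A=A^r\cup A^l\cup A^{bi}$ has as states those of $P$ plus a new state $u$, and exactly the following transitions: $p\xrightarrow{a}_\Diamond p'$ for each $p\xrightarrow{a}p'$ in $P$; $p\xrightarrow{a}_\Box p'$ for each $p\xrightarrow{a}p'$ in $P$ with $a\in A^r\cup A^{bi}$; $p\xrightarrow{a}_\Diamond u$ for each $a\in A^r$ and state $p$ of $P$; $u\xrightarrow{a}_\Diamond u$ for each $a\in A$. -}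

module Defs where

open import Level using (Level; _⊔_; suc)
open import Data.Empty.Polymorphic using (⊥)
open import Data.Maybe.Base using (Maybe; just; nothing)
open import Data.Product.Base using (_×_; ∃-syntax)
open import Data.Sum.Base using (_⊎_)
open import Data.Unit.Polymorphic using (⊤)
open import Relation.Unary using (Pred; _∈_; _∪_; Universal) renaming (_⊥_ to Disjoint)

record Signature {a} (A : Set a) (s : Level) : Set (a ⊔ suc s) where
  field
    Aʳ Aˡ Aᵇⁱ : Pred A s
    covers    : Universal (Aʳ ∪ Aˡ ∪ Aᵇⁱ)
    r⊥l       : Disjoint Aʳ Aˡ
    r⊥bi      : Disjoint Aʳ Aᵇⁱ
    l⊥bi      : Disjoint Aˡ Aᵇⁱ

record LTS {a} (A : Set a) (p t : Level) : Set (a ⊔ suc (p ⊔ t)) where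
  field
    State  : Set p
    _⟶[_]_ : State → A → State → Set t

record MTS {a} (A : Set a) (p t : Level) : Set (a ⊔ suc (p ⊔ t)) where
  field
    State    : Set p
    _⟶◇[_]_  : State → A → State → Set t
    _⟶□[_]_  : State → A → State → Set t
    must⇒may : ∀ {x a y} → x ⟶□[ a ] y → x ⟶◇[ a ] y

infixr 7 _∧_
infixr 6 _∨_
infixr 8 [_]_ ⟨_⟩_ [_∣_]_ ⟨_∣_⟩_

data BLFormula {a} (A : Set a) : Set a where
  ff tt   : BLFormula A
  _∧_ _∨_ : BLFormula A → BLFormula A → BLFormula A
  [_]_    : A → BLFormula A → BLFormula A
  ⟨_⟩_    : A → BLFormula A → BLFormula A

-- The second argument of each modality is the side condition on its action.
data CCFormula {a s} {A : Set a} (S : Signature A s) : Set (a ⊔ s) where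
  ff tt   : CCFormula S
  _∧_ _∨_ : CCFormula S → CCFormula S → CCFormula S
  [_∣_]_  : let open Signature S in
            (b : A) → b ∈ Aˡ ∪ Aᵇⁱ → CCFormula S → CCFormula S
  ⟨_∣_⟩_  : let open Signature S in
            (a : A) → a ∈ Aʳ ∪ Aᵇⁱ → CCFormula S → CCFormula S

infix 4 _,_⊨BL_ _,_⊨CC_

_,_⊨BL_ : ∀ {a p t} {A : Set a} (P : MTS A p t) →
          MTS.State P → BLFormula A → Set (p ⊔ t)
P , x ⊨BL ff        = ⊥
P , x ⊨BL tt        = ⊤
P , x ⊨BL (φ ∧ ψ)   = (P , x ⊨BL φ) × (P , x ⊨BL ψ)
P , x ⊨BL (φ ∨ ψ)   = (P , x ⊨BL φ) ⊎ (P , x ⊨BL ψ)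
P , x ⊨BL ([ a ] φ) = ∀ y → x ⟶◇[ a ] y → P , y ⊨BL φ
  where open MTS P
P , x ⊨BL (⟨ a ⟩ φ) = ∃[ y ] (x ⟶□[ a ] y × (P , y ⊨BL φ))
  where open MTS P

_,_⊨CC_ : ∀ {a s p t} {A : Set a} {S : Signature A s} (P : LTS A p t) →
          LTS.State P → CCFormula S → Set (p ⊔ t)
P , x ⊨CC ff            = ⊥
P , x ⊨CC tt            = ⊤
P , x ⊨CC (φ ∧ ψ)       = (P , x ⊨CC φ) × (P , x ⊨CC ψ)
P , x ⊨CC (φ ∨ ψ)       = (P , x ⊨CC φ) ⊎ (P , x ⊨CC ψ)
P , x ⊨CC ([ b ∣ _ ] φ) = ∀ y → x ⟶[ b ] y → P , y ⊨CC φ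
  where open LTS P
P , x ⊨CC (⟨ a ∣ _ ⟩ φ) = ∃[ y ] (x ⟶[ a ] y × (P , y ⊨CC φ))
  where open LTS P

module _ {a s p t} {A : Set a} (S : Signature A s) (P : LTS A p t) where
  open Signature S
  open LTS P

  -- The states of P are embedded by just; the extra state u is nothing.
  data May : Maybe State → A → Maybe State → Set (a ⊔ s ⊔ p ⊔ t) where
    step : ∀ {x a y} → x ⟶[ a ] y → May (just x) a (just y)
    to-u : ∀ {x a} → a ∈ Aʳ → May (just x) a nothing
    loop : ∀ {a} → May nothing a nothing

  data Must : Maybe State → A → Maybe State → Set (a ⊔ s ⊔ p ⊔ t) where
    step : ∀ {x a y} → a ∈ Aʳ ∪ Aᵇⁱ → x ⟶[ a ] y → Must (just x) a (just y)

  𝓜 : MTS A p (a ⊔ s ⊔ p ⊔ t)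
  𝓜 = record
    { State    = Maybe State
    ; _⟶◇[_]_  = May
    ; _⟶□[_]_  = Must
    ; must⇒may = λ { (step _ x⟶y) → step x⟶y }
    }

𝓜ᶠ : ∀ {a s} {A : Set a} {S : Signature A s} → CCFormula S → BLFormula A
𝓜ᶠ ff            = ff
𝓜ᶠ tt            = tt
𝓜ᶠ (φ ∧ ψ)       = 𝓜ᶠ φ ∧ 𝓜ᶠ ψ
𝓜ᶠ (φ ∨ ψ)       = 𝓜ᶠ φ ∨ 𝓜ᶠ ψ
𝓜ᶠ ([ b ∣ _ ] φ) = [ b ] 𝓜ᶠ φ
𝓜ᶠ (⟨ a ∣ _ ⟩ φ) = ⟨ a ⟩ 𝓜ᶠ φ

{-# OPTIONS --safe #-}

-- Induction on φ. The transitions that 𝓜 adds never matter: a box modality has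
-- its action in Aˡ ∪ Aᵇⁱ, which is disjoint from Aʳ, so no may transition on it
-- leads to u; a diamond modality has its action in Aʳ ∪ Aᵇⁱ, where must
-- transitions are exactly those of P.
module Submission where

open import Defs
open import Data.Maybe.Base using (just; nothing)
open import Data.Product.Base using (_,_)
open import Data.Product.Function.NonDependent.Propositional using (_×-⇔_)
open import Data.Sum.Base using (inj₁; inj₂)
open import Data.Sum.Function.Propositional using (_⊎-⇔_)
open import Function.Bundles using (_⇔_; mk⇔; module Equivalence)
open import Relation.Nullary.Negation using (contradiction)
open import Relation.Unary using (_∈_; _∉_; _∪_)

module _ {a s} {A : Set a} (S : Signature A s) where
  open Signature S

  Aˡ∪Aᵇⁱ⇒∉Aʳ : ∀ {b} → b ∈ Aˡ ∪ Aᵇⁱ → b ∉ Aʳ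
  Aˡ∪Aᵇⁱ⇒∉Aʳ (inj₁ b∈l)  b∈r = r⊥l (b∈r , b∈l)
  Aˡ∪Aᵇⁱ⇒∉Aʳ (inj₂ b∈bi) b∈r = r⊥bi (b∈r , b∈bi)

proposition5 : ∀ {a s p t} {A : Set a} (S : Signature A s) (P : LTS A p t)
    (φ : CCFormula S) (x : LTS.State P) →
    (P , x ⊨CC φ) ⇔ (𝓜 S P , just x ⊨BL 𝓜ᶠ φ)
proposition5 S P ff      x = mk⇔ (λ ()) (λ ())
-- Both maps land in the unit type, so eta determines them.
proposition5 S P tt      x = mk⇔ _ _
proposition5 S P (φ ∧ ψ) x = proposition5 S P φ x ×-⇔ proposition5 S P ψ x
proposition5 S P (φ ∨ ψ) x = proposition5 S P φ x ⊎-⇔ proposition5 S P ψ x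
proposition5 S P ([ b ∣ b∈ ] φ) x = mk⇔
  (λ { h (just y) (step x⟶y) → to (proposition5 S P φ y) (h y x⟶y)
     -- The induction hypothesis covers only states `just y`, so a transition to u has to be
     -- refuted: `to-u` would put `b` in `Aʳ`.
     ; h nothing  (to-u b∈r) → contradiction b∈r (Aˡ∪Aᵇⁱ⇒∉Aʳ S b∈) })
  (λ h y x⟶y → from (proposition5 S P φ y) (h (just y) (step x⟶y)))
  where open Equivalence
proposition5 S P (⟨ a ∣ a∈ ⟩ φ) x = mk⇔
  -- The side condition `a∈` turns the step of `P` into a must transition.
  (λ { (y , x⟶y , h) → just y , step a∈ x⟶y , to (proposition5 S P φ y) h })
  -- No `Must` transition enters `nothing`, so the witness is a state of `P`.
  (λ { (just y , step _ x⟶y , h) → y , x⟶y , from (proposition5 S P φ y) h })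
  where open Equivalence
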